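{- The function $\mathcal{B}=\mathcal{S}\circ\mathcal{D}:\mathcal{F}^{(n\ldots 1)}\to\mathcal{T}_n$ is a bijection with the following property. Suppose $\mathbf{s}=\langle s_1,\ldots,s_{n-1}\rangle\in\mathcal{F}^{(n\ldots 1)}$ and $T=\mathcal{B}(\mathbf{s})$, where $T$ has edges $\{e_1,\ldots,e_{n-1}\}$. Then $$\{|\mathrm{C\text{ - }Index}(s_1)|,\ldots,|\mathrm{C\text{ - }Index}(s_{n-1})|\}=\{|\mathrm{T\text{ - }Index}(e_1)|,\ldots,|\mathrm{T\text{ - }Index}(e_{n-1})|\}.$$
   Context: $\mathbf{S}_n$ is the symmetric group on $[n]=\{1,\ldots,n\}$; permutations are multiplied from left to right (in $p\cdot q$, $p$ is applied first). A transposition sequence over $\mathbf{S}_n$ is a finite sequence $\langle s_1,\ldots,s_m\rangle$ of transpositions; its product is $s_1\cdot s_2\cdots s_m$. It is identified with the labeled graph on vertex set $[n]$ having, for each $s_i=(x_i,y_i)$, an edge labeled $i$ between $x_i$ and $y_i$. $\mathcal{F}^{(n\ldots 1)}$ is the set of length $n-1$ transposition sequences over $\mathbf{S}_n$ with product the cycle $(n,\ldots,2,1)$ (mapping $n\mapsto n-1\mapsto\cdots\mapsto1\mapsto n$), and $\mathcal{F}^{(1\ldots n)}$ is the set of those with product $(1,2,\ldots,n)$. The graphs of all these sequences are trees (Dénes). $\mathcal{T}_n$ is the set of trees on $n$ vertices whose vertices are labeled with distinct labels from $[n]$. $\mathcal{D}:\mathcal{F}^{(n\ldots 1)}\to\mathcal{F}^{(1\ldots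 n)}$ sends a transposition sequence to its dual, defined as follows. For $\mathbf{s}=\langle s_1,\ldots,s_m\rangle$, regard a permutation $A$ as assigning to each mind $M$ the body $A(M)$, with $M$ said to be above $A(M)$. Let $A_0$ be the identity and let $A_k$ be obtained from $A_{k-1}$ by exchanging the bodies $x$ and $y$, where $s_k=(x,y)$ (so $A_k=s_1\cdots s_k$). The dual of $\mathbf{s}$ is $\langle s_1',\ldots,s_m'\rangle$, where for $s_k=(x,y)$ one puts $s_k'=(x',y')$ with $x'$ above $x$ and $y'$ above $y$ in $A_{k-1}$. $\mathcal{S}:\mathcal{F}^{(1\ldots n)}\to\mathcal{T}_n$ is defined on a tree with labeled vertices and edges as follows: the vertex $1$ keeps the label $1$; every other vertex $v$ is relabeled $1+w$, where $w$ is the label of the edge incident to $v$ that is closest to the vertex $1$ (the first edge on the path from $v$ to $1$); then the edge labels are erased. C-Index: for $\mathbf{s}=\langle s_1,\ldots,s_{n-1}\rangle$ over $\mathbf{S}_n$ that is a tree and $s_k=(x,y)$, the product of $\mathbf{s}$ is an $n$-cycle that can be written $(x,x_1,\ldots,x_a,y,y_1,\ldots,y_b)$; set $\mathrm{C\text{ - }Index}(s_k)=\min(|\{x,x_1,\ldots,x_a\}|,|\{y,y_1,\ldots,y_b\}|)$. T-Index: for an edge $e$ of a tree, $\mathrm{T\text{ - }Index}(e)=\min(|A|,|B|)$, where $A,B$ are the vertex sets of the two connected components obtained by removing $e$. -}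

module Defs where

open import Data.Empty using (⊥-elim; ⊥-elim-irr)
open import Data.Fin.Base using (Fin; zero; suc; fromℕ; inject₁; punchIn; punchOut; _<_)
open import Data.Fin.Induction using (<-weakInduction)
open import Data.Fin.Permutation as Perm
  using (Permutation′; permutation; transpose; flip; _∘ₚ_; _⟨$⟩ʳ_; _⟨$⟩ˡ_; inverseˡ; inverseʳ)
import Data.Fin.Permutation.Components as PC
open import Data.Fin.Properties
  using (_≟_; _<?_; any?; <-cmp; <⇒≢; suc-injective; punchOut-injective;
         punchInᵢ≢i; punchOut-cong; punchOut-punchIn; punchIn-punchOut; injective⇒≤)
open import Data.Fin.Relation.Unary.Top
  using (View; view; ‵fromℕ; ‵inj₁; view-fromℕ; view-inject₁)
open import Data.List.Base
  using (List; []; _∷_; allFin; filter; length; map; iterate; takeWhile; dropWhile; cartesianProduct)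
open import Data.List.Membership.Propositional using (_∈_)
open import Data.List.Membership.Propositional.Properties using (∈-allFin)
open import Data.List.Relation.Unary.All as All using (All; []; _∷_)
open import Data.List.Relation.Unary.AllPairs using ([]; _∷_)
open import Data.List.Relation.Unary.Any using (here; there)
open import Data.List.Relation.Unary.Unique.Propositional using (Unique)
open import Data.Nat.Base using (ℕ; zero; suc; _+_; _⊓_; _≤_; s≤s)
import Data.Nat.Properties as ℕₚ
open import Data.Product.Base as Product
  using (Σ; ∃; ∃₂; _×_; _,_; proj₁; proj₂; uncurry)
open import Data.Sum.Base as Sum using (_⊎_; inj₁; inj₂; [_,_]′)
open import Data.Vec.Base using (Vec; []; _∷_; lookup)
open import Function.Base using (_∘_; _on_; id)
open import Function.Bundles using (_⇔_)
open import Function.Definitions using (Injective)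
open import Level using (0ℓ)
open import Relation.Binary.Core using (Rel)
open import Relation.Binary.Construct.Closure.ReflexiveTransitive
  using (Star; ε; _◅_; _◅◅_; gmap; reverse; kleisliStar; return)
open import Relation.Binary.Definitions
  using (Symmetric; Decidable; tri<; tri≈; tri>)
open import Relation.Binary.PropositionalEquality
  using (_≡_; _≢_; refl; sym; trans; cong; subst)
open import Relation.Nullary using (¬_; Dec; yes; no; contradiction)
open import Relation.Nullary.Decidable
  using (¬?; _×-dec_; _⊎-dec_; map′; dec-true; dec-false)

private
  variable
    m n L : ℕ

-- The element i of [n] is encoded by the index i - 1 in Fin n; in
-- particular the vertex 1 is zero.  Where sequences of length n - 1 over
-- [n] are meant, n is suc m.

-- A transposition is an unordered pair; storing it in increasing order
-- makes _≡_ the right equality.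
record Transposition (n : ℕ) : Set where
  constructor mkTransposition
  field
    lo hi  : Fin n
    .lo<hi : lo < hi

  ends : Fin n × Fin n
  ends = lo , hi

  ⟦_⟧ₜ : Permutation′ n
  ⟦_⟧ₜ = transpose lo hi

open Transposition public using (lo; hi; ends; ⟦_⟧ₜ)

lo≢hi : (t : Transposition n) → lo t ≢ hi t
lo≢hi (mkTransposition _ _ lo<hi) eq = ⊥-elim-irr (<⇒≢ lo<hi eq)

transposition : (x y : Fin n) → x ≢ y → Transposition n
transposition x y x≢y with <-cmp x y
... | tri< x<y _ _ = mkTransposition x y x<y
... | tri≈ _ x≡y _ = contradiction x≡y x≢y
... | tri> _ _ y<x = mkTransposition y x y<x

-- _∘ₚ_ applies its left argument first.
prod : Vec (Transposition n) L → Permutation′ n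
prod []       = Perm.id
prod (t ∷ ts) = ⟦ t ⟧ₜ ∘ₚ prod ts

down : Fin (suc m) → Fin (suc m)
down zero    = fromℕ _
down (suc i) = inject₁ i

upView : {i : Fin (suc m)} → View i → Fin (suc m)
upView ‵fromℕ            = zero
upView (‵inj₁ {i = i} _) = suc i

up : Fin (suc m) → Fin (suc m)
up i = upView (view i)

up-inject₁ : (i : Fin m) → up (inject₁ i) ≡ suc i
up-inject₁ i rewrite view-inject₁ i = refl

up-down : (i : Fin (suc m)) → up (down i) ≡ i
up-down {m} zero rewrite view-fromℕ m = refl
up-down (suc i)                       = up-inject₁ i

down-up : (i : Fin (suc m)) → down (up i) ≡ i
down-up i = go (view i)
  where
  go : {i : Fin (suc m)} (v : View i) → down (upView v) ≡ i
  go ‵fromℕ    = refl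
  go (‵inj₁ _) = refl

-- The cycle (n, …, 2, 1).
descending : Permutation′ (suc m)
descending = permutation down up down-up up-down

-- The cycle (1, 2, …, n).
ascending : Permutation′ (suc m)
ascending = permutation up down up-down down-up

Factorization : Permutation′ (suc m) → Set
Factorization {m} π = Σ (Vec (Transposition (suc m)) m) λ s → prod s Perm.≈ π

F↓ F↑ : ℕ → Set
F↓ m = Factorization (descending {m})
F↑ m = Factorization (ascending {m})

infix 4 _≈F_

_≈F_ : Rel (F↓ m) 0ℓ
_≈F_ = _≡_ on proj₁

-- A maps minds to bodies, so A ⟨$⟩ˡ x is the mind above the body x.
above : Permutation′ n → Transposition n → Transposition n
above A t = transposition (A ⟨$⟩ˡ lo t) (A ⟨$⟩ˡ hi t) ne
  where
  ne : A ⟨$⟩ˡ lo t ≢ A ⟨$⟩ˡ hi t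
  ne eq = lo≢hi t (trans (sym (inverseʳ A)) (trans (cong (A ⟨$⟩ʳ_) eq) (inverseʳ A)))

dualFrom : Permutation′ n → Vec (Transposition n) L → Vec (Transposition n) L
dualFrom A []       = []
dualFrom A (t ∷ ts) = above A t ∷ dualFrom (A ∘ₚ ⟦ t ⟧ₜ) ts

dual : Vec (Transposition n) L → Vec (Transposition n) L
dual = dualFrom Perm.id

transpose-at₁ : (x y : Fin n) {k : Fin n} → k ≡ x → PC.transpose x y k ≡ y
transpose-at₁ x y {k} eq rewrite dec-true (k ≟ x) eq = refl

transpose-at₂ : (x y : Fin n) {k : Fin n} → k ≢ x → k ≡ y → PC.transpose x y k ≡ x
transpose-at₂ x y {k} ne eq rewrite dec-false (k ≟ x) ne | dec-true (k ≟ y) eq = refl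

transpose-at₃ : (x y : Fin n) {k : Fin n} → k ≢ x → k ≢ y → PC.transpose x y k ≡ k
transpose-at₃ x y {k} ne ne′ rewrite dec-false (k ≟ x) ne | dec-false (k ≟ y) ne′ = refl

transpose-comm : (x y k : Fin n) → PC.transpose x y k ≡ PC.transpose y x k
transpose-comm x y k = go (k ≟ x) (k ≟ y)
  where
  go : Dec (k ≡ x) → Dec (k ≡ y) → PC.transpose x y k ≡ PC.transpose y x k
  go (yes p) (yes q) = trans (transpose-at₁ x y p) (trans (trans (sym q) p) (sym (transpose-at₁ y x q)))
  go (yes p) (no ¬q) = trans (transpose-at₁ x y p) (sym (transpose-at₂ y x ¬q p))
  go (no ¬p) (yes q) = trans (transpose-at₂ x y ¬p q) (sym (transpose-at₁ y x q))
  go (no ¬p) (no ¬q) = trans (transpose-at₃ x y ¬p ¬q) (sym (transpose-at₃ y x ¬q ¬p))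

transposition-prop : (x y : Fin n) (x≢y : x ≢ y) (k : Fin n) →
                     ⟦ transposition x y x≢y ⟧ₜ ⟨$⟩ʳ k ≡ PC.transpose x y k
transposition-prop x y x≢y k with <-cmp x y
... | tri< _ _ _   = refl
... | tri≈ _ x≡y _ = contradiction x≡y x≢y
... | tri> _ _ _   = transpose-comm y x k

conjugate : (A : Permutation′ n) (t : Transposition n) (i : Fin n) →
            A ⟨$⟩ʳ (⟦ above A t ⟧ₜ ⟨$⟩ʳ i) ≡ ⟦ t ⟧ₜ ⟨$⟩ʳ (A ⟨$⟩ʳ i)
conjugate A t i = trans (cong (A ⟨$⟩ʳ_) (transposition-prop x′ y′ _ i)) (cases (i ≟ x′) (i ≟ y′))
  where
  x  = lo t
  y  = hi t
  x′ = A ⟨$⟩ˡ x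
  y′ = A ⟨$⟩ˡ y

  to : {z : Fin _} → i ≡ A ⟨$⟩ˡ z → A ⟨$⟩ʳ i ≡ z
  to eq = trans (cong (A ⟨$⟩ʳ_) eq) (inverseʳ A)

  to≢ : {z : Fin _} → i ≢ A ⟨$⟩ˡ z → A ⟨$⟩ʳ i ≢ z
  to≢ ne eq = ne (trans (sym (inverseˡ A)) (cong (A ⟨$⟩ˡ_) eq))

  cases : Dec (i ≡ x′) → Dec (i ≡ y′) → A ⟨$⟩ʳ PC.transpose x′ y′ i ≡ PC.transpose x y (A ⟨$⟩ʳ i)
  cases (yes p) _       = trans (cong (A ⟨$⟩ʳ_) (transpose-at₁ x′ y′ p))
                            (trans (inverseʳ A) (sym (transpose-at₁ x y (to p))))
  cases (no ¬p) (yes q) = trans (cong (A ⟨$⟩ʳ_) (transpose-at₂ x′ y′ ¬p q))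
                            (trans (inverseʳ A) (sym (transpose-at₂ x y (to≢ ¬p) (to q))))
  cases (no ¬p) (no ¬q) = trans (cong (A ⟨$⟩ʳ_) (transpose-at₃ x′ y′ ¬p ¬q))
                            (sym (transpose-at₃ x y (to≢ ¬p) (to≢ ¬q)))

⟦⟧ₜ-involutive : (t : Transposition n) (i : Fin n) →
                 ⟦ t ⟧ₜ ⟨$⟩ʳ (⟦ t ⟧ₜ ⟨$⟩ʳ i) ≡ i
⟦⟧ₜ-involutive t i = trans (transpose-comm (lo t) (hi t) (⟦ t ⟧ₜ ⟨$⟩ʳ i)) (inverseˡ ⟦ t ⟧ₜ {i})

prod-dualFrom : (A : Permutation′ n) (ts : Vec (Transposition n) L) →
                prod (dualFrom A ts) Perm.≈ A ∘ₚ flip (prod ts) ∘ₚ flip A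
prod-dualFrom A []       i = sym (inverseˡ A)
prod-dualFrom A (t ∷ ts) i = trans
  (prod-dualFrom (A ∘ₚ ⟦ t ⟧ₜ) ts (⟦ above A t ⟧ₜ ⟨$⟩ʳ i))
  (cong (λ z → A ⟨$⟩ˡ (⟦ t ⟧ₜ ⟨$⟩ˡ (prod ts ⟨$⟩ˡ z)))
        (trans (cong (⟦ t ⟧ₜ ⟨$⟩ʳ_) (conjugate A t i)) (⟦⟧ₜ-involutive t _)))

D : F↓ m → F↑ m
D (s , eq) = dual s , λ i → trans (prod-dualFrom Perm.id s i)
  (trans (cong (prod s ⟨$⟩ˡ_) (trans (sym (down-up i)) (sym (eq (up i)))))
         (inverseˡ (prod s)))

-- Star R u v is the type of walks from u to v.
vertices : {R : Rel (Fin n) 0ℓ} {u v : Fin n} → Star R u v → List (Fin n)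
vertices {u = u} ε       = u ∷ []
vertices {u = u} (_ ◅ p) = u ∷ vertices p

Simple : {R : Rel (Fin n) 0ℓ} {u v : Fin n} → Star R u v → Set
Simple p = Unique (vertices p)

-- Kleene's algorithm: Via ws is reachability through intermediate
-- vertices from ws.
module _ {R : Rel (Fin n) 0ℓ} (R? : Decidable R) where
  private
    Via : List (Fin n) → Rel (Fin n) 0ℓ
    Via []       u v = u ≡ v ⊎ R u v
    Via (w ∷ ws) u v = Via ws u v ⊎ Via ws u w × Via ws w v

    via? : ∀ ws → Decidable (Via ws)
    via? []       u v = (u ≟ v) ⊎-dec R? u v
    via? (w ∷ ws) u v = via? ws u v ⊎-dec (via? ws u w ×-dec via? ws w v)

    base : ∀ ws {u v} → u ≡ v ⊎ R u v → Via ws u v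
    base []       b = b
    base (w ∷ ws) b = inj₁ (base ws b)

    glue : ∀ {ws u v w} → w ∈ ws → Via ws u w → Via ws w v → Via ws u v
    glue (here refl) p q = inj₂ ([ id , proj₁ ]′ p , [ id , proj₂ ]′ q)
    glue (there w∈)  (inj₁ p)        (inj₁ q)        = inj₁ (glue w∈ p q)
    glue (there w∈)  (inj₁ p)        (inj₂ (q , q′)) = inj₂ (glue w∈ p q , q′)
    glue (there w∈)  (inj₂ (p , p′)) (inj₁ q)        = inj₂ (p , glue w∈ p′ q)
    glue (there w∈)  (inj₂ (p , _))  (inj₂ (_ , q′)) = inj₂ (p , q′)

    sound : ∀ ws {u v} → Via ws u v → Star R u v
    sound []       (inj₁ refl)    = ε
    sound []       (inj₂ r)       = return r
    sound (w ∷ ws) (inj₁ p)       = sound ws p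
    sound (w ∷ ws) (inj₂ (p , q)) = sound ws p ◅◅ sound ws q

    complete : ∀ {u v} → Star R u v → Via (allFin n) u v
    complete ε       = base (allFin n) (inj₁ refl)
    complete (r ◅ p) = glue (∈-allFin _) (base (allFin n) (inj₂ r)) (complete p)

  connected? : Decidable (Star R)
  connected? u v = map′ (sound (allFin n)) complete (via? (allFin n) u v)

Joins : Fin n × Fin n → Rel (Fin n) 0ℓ
Joins (x , y) u v = u ≡ x × v ≡ y ⊎ u ≡ y × v ≡ x

joins? : (e : Fin n × Fin n) → Decidable (Joins e)
joins? (x , y) u v = (u ≟ x ×-dec v ≟ y) ⊎-dec (u ≟ y ×-dec v ≟ x)

record Graph (n : ℕ) : Set₁ where
  infix 4 _~_ _~?_
  field
    _~_      : Rel (Fin n) 0ℓ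
    _~?_     : Decidable _~_
    ~-sym    : Symmetric _~_
    ~-irrefl : ∀ {u} → ¬ u ~ u

  edges : List (Fin n × Fin n)
  edges = filter (λ (u , v) → u <? v ×-dec u ~? v) (cartesianProduct (allFin n) (allFin n))

  -- A cycle: an edge between u and v, closed up by a path from v to u on
  -- at least three vertices.
  Cycle : Set
  Cycle = ∃₂ λ u v → u ~ v × Σ (Star _~_ v u) λ p → Simple p × 3 ≤ length (vertices p)

  delete : Fin n × Fin n → Rel (Fin n) 0ℓ
  delete e a b = a ~ b × ¬ Joins e a b

  delete? : (e : Fin n × Fin n) → Decidable (delete e)
  delete? e a b = (a ~? b) ×-dec ¬? (joins? e a b)

  component : Fin n × Fin n → Fin n → List (Fin n)
  component e u = filter (connected? (delete? e) u) (allFin n)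

  tIndex : Fin n × Fin n → ℕ
  tIndex e@(u , v) = length (component e u) ⊓ length (component e v)

record Tree (n : ℕ) : Set₁ where
  field
    graph : Graph n
  open Graph graph public
  field
    connected : ∀ u v → Star _~_ u v
    acyclic   : ¬ Cycle

infix 4 _≈T_

_≈T_ : Rel (Tree n) 0ℓ
T ≈T T′ = ∀ u v → Tree._~_ T u v ⇔ Tree._~_ T′ u v

EdgeLabeled : ℕ → ℕ → Set
EdgeLabeled n L = Fin L → Fin n × Fin n

Adj : EdgeLabeled n L → Rel (Fin n) 0ℓ
Adj e u v = ∃ λ k → Joins (e k) u v

-- k is the label of the first edge on a path from v to r.  In a tree it is
-- unique; see firstEdge-unique.
FirstEdge : EdgeLabeled n L → (r v : Fin n) → Fin L → Set
FirstEdge e r v k = ∃ λ u → Σ (Joins (e k) v u) λ j →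
                    Σ (Star (Adj e) u r) λ p → Simple {R = Adj e} ((k , j) ◅ p)

joins-sym : (e : Fin n × Fin n) → Symmetric (Joins e)
joins-sym e (inj₁ (p , q)) = inj₂ (q , p)
joins-sym e (inj₂ (p , q)) = inj₁ (q , p)

joins-same : (e : Fin n × Fin n) {u v a b : Fin n} → Joins e u v → Joins e a b →
             u ≡ a × v ≡ b ⊎ u ≡ b × v ≡ a
joins-same _ (inj₁ (refl , refl)) (inj₁ (refl , refl)) = inj₁ (refl , refl)
joins-same _ (inj₁ (refl , refl)) (inj₂ (refl , refl)) = inj₂ (refl , refl)
joins-same _ (inj₂ (refl , refl)) (inj₁ (refl , refl)) = inj₂ (refl , refl)
joins-same _ (inj₂ (refl , refl)) (inj₂ (refl , refl)) = inj₁ (refl , refl)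

cut : {R : Rel (Fin n) 0ℓ} {u v w : Fin n} (p : Star R u v) → w ∈ vertices p →
      Simple p → Σ (Star R w v) Simple
cut ε       (here refl) s       = ε , s
cut (r ◅ p) (here refl) s       = r ◅ p , s
cut (r ◅ p) (there w∈)  (_ ∷ s) = cut p w∈ s

avoids : (u : Fin n) (vs : List (Fin n)) → u ∈ vs ⊎ All (u ≢_) vs
avoids u [] = inj₂ []
avoids u (v ∷ vs) with u ≟ v | avoids u vs
... | yes p | _       = inj₁ (here p)
... | no _  | inj₁ u∈ = inj₁ (there u∈)
... | no ¬p | inj₂ ps = inj₂ (¬p ∷ ps)

erase : {R : Rel (Fin n) 0ℓ} {u v : Fin n} → Star R u v → Σ (Star R u v) Simple
erase ε = ε , [] ∷ []
erase {u = u} (r ◅ p) with erase p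
... | q , s with avoids u (vertices q)
...   | inj₁ u∈ = cut q u∈ s
...   | inj₂ u∉ = r ◅ q , u∉ ∷ s

firstEdge : (e : EdgeLabeled n L) (r v : Fin n) → v ≢ r → Star (Adj e) v r →
            ∃ (FirstEdge e r v)
firstEdge e r v v≢r w with erase w
... | ε , _             = contradiction refl v≢r
... | ((k , j) ◅ p) , s = k , _ , j , p , s

merge : (a b : Fin (suc n)) → a ≢ b → Fin (suc n) → Fin n
merge a b a≢b z with a ≟ z
... | yes _  = punchOut a≢b
... | no a≢z = punchOut a≢z

merge-≡ : (a b : Fin (suc n)) (a≢b : a ≢ b) → merge a b a≢b a ≡ merge a b a≢b b
merge-≡ a b a≢b with a ≟ a | a ≟ b
... | no a≢a | _       = contradiction refl a≢a
... | yes _  | yes a≡b = contradiction a≡b a≢b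
... | yes _  | no _    = punchOut-cong a refl

merge-onto : (a b : Fin (suc n)) (a≢b : a ≢ b) (i : Fin n) →
             merge a b a≢b (punchIn a i) ≡ i
merge-onto a b a≢b i with a ≟ punchIn a i
... | yes p = contradiction (sym p) (punchInᵢ≢i a i)
... | no  _ = trans (punchOut-cong a refl) (punchOut-punchIn a)

record Quotient (e : EdgeLabeled n L) : Set where
  field
    q       : ℕ
    bound   : n ≤ q + L
    class   : Fin n → Fin q
    onto    : ∀ i → ∃ λ u → class u ≡ i
    respect : ∀ k → uncurry (_≡_ on class) (e k)

quotient : ∀ L (e : EdgeLabeled n L) → Quotient e
quotient {n} zero e = record
  { q = n ; bound = ℕₚ.m≤m+n n 0 ; class = id ; onto = _, refl ; respect = λ () }
quotient {n} (suc L) e = step (quotient L (e ∘ suc))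
  where
  x = proj₁ (e zero)
  y = proj₂ (e zero)

  step : Quotient (e ∘ suc) → Quotient e
  step record { q = zero ; class = c } with () ← c x
  step record { q = suc q ; bound = b ; class = c ; onto = o ; respect = r } with c x ≟ c y
  ... | yes p = record
    { q = suc q
    ; bound = ℕₚ.≤-trans b (ℕₚ.+-monoʳ-≤ (suc q) (ℕₚ.n≤1+n L))
    ; class = c ; onto = o
    ; respect = λ { zero → p ; (suc k) → r k } }
  ... | no ¬p = record
    { q = q
    ; bound = subst (n ≤_) (sym (ℕₚ.+-suc q L)) b
    ; class = merge (c x) (c y) ¬p ∘ c
    ; onto = λ i → let u , eq = o (punchIn (c x) i) in
                   u , trans (cong (merge (c x) (c y) ¬p) eq) (merge-onto (c x) (c y) ¬p i)
    ; respect = λ { zero → merge-≡ (c x) (c y) ¬p ; (suc k) → cong (merge (c x) (c y) ¬p) (r k) } }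

module _ {e : EdgeLabeled n L} {q : ℕ} {class : Fin n → Fin q}
         (respect : ∀ k → uncurry (_≡_ on class) (e k)) where
  class-constant : ∀ {u v} → Star (Adj e) u v → class u ≡ class v
  class-constant ε = refl
  class-constant ((k , inj₁ (refl , refl)) ◅ w) = trans (respect k) (class-constant w)
  class-constant ((k , inj₂ (refl , refl)) ◅ w) = trans (sym (respect k)) (class-constant w)

connected⇒enoughEdges : (e : EdgeLabeled n L) → (∀ u v → Star (Adj e) u v) → n ≤ suc L
connected⇒enoughEdges {n} {L} e conn = go (quotient L e)
  where
  go : Quotient e → n ≤ suc L
  go record { q = zero ; bound = b } = ℕₚ.m≤n⇒m≤1+n b
  go record { q = suc zero ; bound = b } = b
  go record { q = suc (suc _) ; onto = o ; respect = r } with o zero | o (suc zero)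
  ... | u , p | v , p′ with () ← trans (sym p) (trans (class-constant {e = e} r (conn u v)) p′)

Without : EdgeLabeled n L → Fin L → Rel (Fin n) 0ℓ
Without e k u v = ∃ λ k′ → k ≢ k′ × Joins (e k′) u v

without-sym : (e : EdgeLabeled n L) (k : Fin L) → Symmetric (Without e k)
without-sym e k (k′ , ne , j) = k′ , ne , joins-sym (e k′) j

bridge : (e : EdgeLabeled (suc m) m) → (∀ u v → Star (Adj e) u v) →
         ∀ k {u v} → Joins (e k) u v → ¬ Star (Without e k) u v
bridge {suc m} e conn k {u} {v} j w = ℕₚ.1+n≰n (connected⇒enoughEdges (e ∘ punchIn k) conn′)
  where
  w⁻¹ : Star (Without e k) v u
  w⁻¹ = reverse (without-sym e k) w

  replace : ∀ {a b} → Adj e a b → Star (Without e k) a b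
  replace (k′ , j′) with k ≟ k′
  ... | no ne = return (k′ , ne , j′)
  ... | yes refl with joins-same (e k) j j′
  ...   | inj₁ (refl , refl) = w
  ...   | inj₂ (refl , refl) = w⁻¹

  relabel : ∀ {a b} → Without e k a b → Adj (e ∘ punchIn k) a b
  relabel {a} {b} (k′ , ne , j′) =
    punchOut ne , subst (λ i → Joins (e i) a b) (sym (punchIn-punchOut ne)) j′

  conn′ : ∀ a b → Star (Adj (e ∘ punchIn k)) a b
  conn′ a b = gmap id relabel (kleisliStar id replace (conn a b))

head∈ : {R : Rel (Fin n) 0ℓ} {u v : Fin n} (p : Star R u v) → u ∈ vertices p
head∈ ε       = here refl
head∈ (_ ◅ _) = here refl

last∈ : {R : Rel (Fin n) 0ℓ} {u v : Fin n} (p : Star R u v) → v ∈ vertices p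
last∈ ε       = here refl
last∈ (_ ◅ p) = there (last∈ p)

avoidEdge : (e : EdgeLabeled n L) {k : Fin L} {v w a b : Fin n} → Joins (e k) v w →
            (p : Star (Adj e) a b) → All (v ≢_) (vertices p) → Star (Without e k) a b
avoidEdge e j ε _ = ε
avoidEdge e {k} j ((k′ , j′) ◅ p) (ne ∷ nes) = (k′ , k≢k′ , j′) ◅ avoidEdge e j p nes
  where
  k≢k′ : k ≢ k′
  k≢k′ refl with joins-same (e k) j j′
  ... | inj₁ (eq , _) = ne eq
  ... | inj₂ (eq , _) = All.lookup nes (head∈ p) eq

firstEdge-injective : (e : EdgeLabeled (suc m) m) → (∀ u v → Star (Adj e) u v) →
  ∀ {r k v w} → FirstEdge e r v k → FirstEdge e r w k → v ≡ w
firstEdge-injective e conn {k = k} (_ , j , p , v∉ ∷ _) (_ , j′ , p′ , w∉ ∷ _)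
  with joins-same (e k) j j′
... | inj₁ (eq , _) = eq
... | inj₂ (refl , refl) = ⊥-elim (bridge e conn k j
        (avoidEdge e j′ p′ w∉ ◅◅ reverse (without-sym e k) (avoidEdge e j p v∉)))

firstEdge-unique : (e : EdgeLabeled (suc m) m) → (∀ u v → Star (Adj e) u v) →
  ∀ {r v k k′} → FirstEdge e r v k → FirstEdge e r v k′ → k ≡ k′
firstEdge-unique e conn {k = k} {k′} (_ , j , p , v∉ ∷ _) (_ , j′ , p′ , v∉′ ∷ _) with k ≟ k′
... | yes eq = eq
... | no  ne = ⊥-elim (bridge e conn k j
        ((k′ , ne , j′) ◅ avoidEdge e j p′ v∉′ ◅◅ reverse (without-sym e k) (avoidEdge e j p v∉)))

injective⇒onto : {f : Fin n → Fin n} → Injective _≡_ _≡_ f → ∀ i → ∃ λ u → f u ≡ i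
injective⇒onto {suc n} {f} inj i with any? (λ u → f u ≟ i)
... | yes p = p
... | no ¬p = ⊥-elim (ℕₚ.1+n≰n (injective⇒≤ {f = λ u → punchOut (ne u)}
                (λ {u} {v} eq → inj (punchOut-injective (ne u) (ne v) eq))))
  where
  ne : ∀ u → i ≢ f u
  ne u eq = ¬p (u , sym eq)

treeOf : (e : EdgeLabeled (suc m) m) → (∀ k → proj₁ (e k) ≢ proj₂ (e k)) →
         (∀ u v → Star (Adj e) u v) → Tree (suc m)
treeOf {m} e loopless conn = record
  { graph     = graph
  ; connected = conn
  ; acyclic   = acyclic
  }
  where
  irrefl : ∀ {u} → ¬ Adj e u u
  irrefl (k , inj₁ (refl , q)) = loopless k q
  irrefl (k , inj₂ (refl , q)) = loopless k (sym q)

  graph : Graph (suc m)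
  graph = record
    { _~_      = Adj e
    ; _~?_     = λ u v → any? λ k → joins? (e k) u v
    ; ~-sym    = λ (k , j) → k , joins-sym (e k) j
    ; ~-irrefl = irrefl
    }

  acyclic : ¬ Graph.Cycle graph
  acyclic (u , v , _ , ε , _ , s≤s ())
  acyclic (u , v , _ , _ ◅ ε , _ , s≤s (s≤s ()))
  acyclic (u , v , (k , j) , (k′ , j′) ◅ (r ◅ p) , (v∉ ∷ u∉ ∷ _) , _) =
    bridge e conn k (joins-sym (e k) j)
      ((k′ , k≢k′ , j′) ◅ avoidEdge e (joins-sym (e k) j) (r ◅ p) v∉)
    where
    k≢k′ : k ≢ k′
    k≢k′ refl with joins-same (e k) j j′
    ... | inj₁ (refl , refl) = irrefl (k , j)
    ... | inj₂ (eq , _)      = All.lookup u∉ (last∈ p) (sym eq)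

labeledGraph : Vec (Transposition n) L → EdgeLabeled n L
labeledGraph s k = ends (lookup s k)

Joins-prod : (s : Vec (Transposition n) L) (v : Fin n) →
             Star (Adj (labeledGraph s)) v (prod s ⟨$⟩ʳ v)
Joins-prod []       v = ε
Joins-prod (t ∷ ts) v = first ◅◅ gmap id (λ (k , j) → suc k , j) (Joins-prod ts (⟦ t ⟧ₜ ⟨$⟩ʳ v))
  where
  R = Adj (labeledGraph (t ∷ ts))
  x = lo t
  y = hi t

  go : Dec (v ≡ x) → Dec (v ≡ y) → Star R v (PC.transpose x y v)
  go (yes p) _       = subst (Star R v) (sym (transpose-at₁ x y p)) (return (zero , inj₁ (p , refl)))
  go (no ¬p) (yes q) = subst (Star R v) (sym (transpose-at₂ x y ¬p q)) (return (zero , inj₂ (q , refl)))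
  go (no ¬p) (no ¬q) = subst (Star R v) (sym (transpose-at₃ x y ¬p ¬q)) ε

  first : Star R v (⟦ t ⟧ₜ ⟨$⟩ʳ v)
  first = go (v ≟ x) (v ≟ y)

factorization-connected : (s : F↑ m) → ∀ u v → Star (Adj (labeledGraph (proj₁ s))) u v
factorization-connected {m} (s , eq) u v = toZero u ◅◅ rev (toZero v)
  where
  _—_ : Rel (Fin (suc m)) 0ℓ
  _—_ = Adj (labeledGraph s)

  rev : Symmetric (Star _—_)
  rev = reverse (λ (k , j) → k , joins-sym (labeledGraph s k) j)

  next : ∀ i → Star _—_ (inject₁ i) (suc i)
  next i = subst (Star _—_ (inject₁ i)) (trans (eq (inject₁ i)) (up-inject₁ i))
                 (Joins-prod s (inject₁ i))

  toZero : ∀ i → Star _—_ i zero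
  toZero = <-weakInduction (λ i → Star _—_ i zero) ε (λ i w → rev (next i) ◅◅ w)

module _ (s : F↑ m) where
  private
    e    = labeledGraph (proj₁ s)
    conn = factorization-connected s

  rootEdge : (i : Fin m) → ∃ (FirstEdge e zero (suc i))
  rootEdge i = firstEdge e zero (suc i) (λ ()) (conn (suc i) zero)

  -- Edge labels are indices in Fin m, one less than the label they stand
  -- for, so that suc encodes w ↦ 1 + w.
  relabel : Fin (suc m) → Fin (suc m)
  relabel zero    = zero
  relabel (suc i) = suc (proj₁ (rootEdge i))

  relabel-injective : Injective _≡_ _≡_ relabel
  relabel-injective {zero}  {zero}  _  = refl
  relabel-injective {suc i} {suc j} eq =
    firstEdge-injective e conn (proj₂ (rootEdge i))
      (subst (FirstEdge e zero (suc j)) (sym (suc-injective eq)) (proj₂ (rootEdge j)))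

  relabeled : EdgeLabeled (suc m) m
  relabeled k = Product.map relabel relabel (e k)

  relabel-Joins : ∀ k {u v} → Joins (e k) u v → Joins (relabeled k) (relabel u) (relabel v)
  relabel-Joins k = Sum.map (Product.map (cong relabel) (cong relabel))
                            (Product.map (cong relabel) (cong relabel))

  relabeled-connected : ∀ a b → Star (Adj relabeled) a b
  relabeled-connected a b with injective⇒onto relabel-injective a | injective⇒onto relabel-injective b
  ... | u , refl | v , refl = gmap relabel (λ (k , j) → k , relabel-Joins k j) (conn u v)

  S : Tree (suc m)
  S = treeOf relabeled (λ k → lo≢hi (lookup (proj₁ s) k) ∘ relabel-injective) relabeled-connected

B : F↓ m → Tree (suc m)
B = S ∘ D

-- The cycle of π containing x, written starting from x (when π is an
-- n-cycle).
cycleFrom : Permutation′ n → Fin n → List (Fin n)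
cycleFrom {n} π x = iterate (π ⟨$⟩ʳ_) x n

-- cycleFrom (prod s) x is split as x, x₁, …, x_a | y, y₁, …, y_b.
cIndex : Vec (Transposition n) L → Fin L → ℕ
cIndex s k = length (takeWhile (λ z → ¬? (z ≟ y)) c) ⊓ length (dropWhile (λ z → ¬? (z ≟ y)) c)
  where
  y = hi (lookup s k)
  c = cycleFrom (prod s) (lo (lookup s k))

{-# OPTIONS --safe #-}

-- Push each edge label of a tree in F↑ away from vertex 1: edge k of S s
-- then joins vertex k + 1 to its parent.  Hence a tree T determines the
-- renamed sequence e₁, …, e_m, whose product σ is an n-cycle (Dénes), and the
-- renaming itself must be i ↦ σ^(i-1)(1), since it carries (1 2 … n) to σ and
-- fixes 1.  So S is a bijection; D is one because it can be undone step by step.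
--
-- For the indices, let s_k = (x, y) and π = prod s.  Deleting the k-th factor of
-- the dual leaves the product (x y) π⁻¹, whose orbits are the two arcs into which
-- x and y cut the cycle π.  Each orbit lies in one component of the dual tree
-- without edge k, and there are two components, so the arcs are the components.

module Submission where

open import Defs
open import Data.List.Base using (map; allFin)
open import Data.List.Relation.Binary.Permutation.Propositional using (_↭_)
open import Data.Nat.Base using (ℕ)
open import Data.Product.Base using (_×_; proj₁)
open import Function.Structures using (IsBijection)

open import Data.Empty using (⊥-elim-irr)
open import Data.Fin.Base as Fin using (Fin; zero; suc; toℕ; fromℕ<; inject₁; punchIn)
open import Data.Fin.Induction using (<-weakInduction)
open import Data.Fin.Permutation as Perm
  using (Permutation′; permutation; _⟨$⟩ʳ_; _⟨$⟩ˡ_; inverseˡ; inverseʳ; flip; _∘ₚ_)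
import Data.Fin.Permutation.Components as PC
open import Data.Fin.Properties
  using (_≟_; _<?_; <-cmp; <-asym; toℕ<n; toℕ-fromℕ; toℕ-inject₁; fromℕ<-injective;
         pigeonhole; injective⇒≤; punchInᵢ≢i; punchOut-punchIn; punchOut-cong)
open import Data.Fin.Relation.Unary.Top using (View; view; ‵fromℕ; ‵inj₁)
open import Data.List.Base as List
  using (List; []; _∷_; _++_; length; filter; takeWhile; dropWhile; iterate; cartesianProduct)
open import Data.List.Membership.Propositional using (_∈_)
open import Data.List.Membership.Propositional.Properties
  using (∈-allFin; ∈-map⁺; ∈-map⁻; ∈-++⁻; ∈-filter⁺; ∈-filter⁻; ∈-tabulate⁺; ∈-cartesianProduct⁺)
open import Data.List.Membership.Propositional.Properties.WithK using (unique∧set⇒bag)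
open import Data.List.Properties
  using (filter-++; filter-all; filter-none; takeWhile++dropWhile; ++-identityʳ;
         map-∘; map-cong; map-++; length-map)
import Data.List.Properties as List
open import Data.List.Relation.Binary.BagAndSetEquality using (∼bag⇒↭)
open import Data.List.Relation.Binary.Permutation.Propositional using (↭-sym; ↭-trans; ↭-reflexive)
import Data.List.Relation.Binary.Permutation.Propositional.Properties as ↭
open import Data.List.Relation.Unary.All as All using (All; []; _∷_)
import Data.List.Relation.Unary.All.Properties as All
open import Data.List.Relation.Unary.AllPairs using ([]; _∷_)
open import Data.List.Relation.Unary.Unique.Propositional using (Unique)
import Data.List.Relation.Unary.Unique.Propositional.Properties as Unique
open import Data.Nat.Base using (zero; suc; _+_; _*_; _∸_; _⊓_; _≤_; _<_; z≤n; s≤s)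
open import Data.Nat.DivMod using (_/_; _%_; m≡m%n+[m/n]*n; m%n<n)
open import Data.Nat.GeneralisedArithmetic using (fold; fold-+)
import Data.Nat.Properties as ℕₚ
open import Data.Product.Base as Product using (∃; _,_; proj₂)
open import Data.Sum.Base as Sum using (_⊎_; inj₁; inj₂; swap)
open import Data.Vec.Base as Vec using (Vec; []; _∷_; lookup; tabulate; removeAt)
open import Data.Vec.Properties
  using (∷-injective; removeAt-punchOut; tabulate∘lookup; tabulate-cong; lookup∘tabulate; lookup-map)
open import Function.Base using (_∘_; id)
open import Function.Bundles using (_⇔_; mk⇔; Equivalence)
open import Function.Definitions using (Injective)
import Function.Properties.Equivalence as ⇔
open import Level using (0ℓ)
open import Relation.Binary.Core using (Rel)
import Relation.Binary.Construct.On as On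
open import Relation.Binary.Construct.Closure.ReflexiveTransitive
  using (Star; ε; _◅_; _◅◅_; gmap; reverse; return)
open import Relation.Binary.Definitions
  using (Decidable; Symmetric; Transitive; Reflexive; tri<; tri≈; tri>)
open import Relation.Binary.PropositionalEquality
  using (_≡_; _≢_; refl; sym; trans; cong; cong₂; subst; subst₂; ≢-sym; isEquivalence)
open import Relation.Nullary using (¬_; Dec; yes; no; contradiction; recompute)
open import Relation.Nullary.Decidable using (¬?; _×-dec_)
import Relation.Unary as U

private
  variable
    m n L : ℕ

-- Orbits of a permutation

fold-suc : {A : Set} (f : A → A) (x : A) (j : ℕ) → fold (f x) f j ≡ f (fold x f j)
fold-suc f x zero    = refl
fold-suc f x (suc j) = cong f (fold-suc f x j)

⟨$⟩ʳ-injective : (π : Permutation′ n) {x y : Fin n} → π ⟨$⟩ʳ x ≡ π ⟨$⟩ʳ y → x ≡ y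
⟨$⟩ʳ-injective π eq = trans (sym (inverseˡ π)) (trans (cong (π ⟨$⟩ˡ_) eq) (inverseˡ π))

⟨$⟩ˡ-injective : (π : Permutation′ n) {x y : Fin n} → π ⟨$⟩ˡ x ≡ π ⟨$⟩ˡ y → x ≡ y
⟨$⟩ˡ-injective π eq = trans (sym (inverseʳ π)) (trans (cong (π ⟨$⟩ʳ_) eq) (inverseʳ π))

iterate≡tabulate : {A : Set} (f : A → A) (x : A) (n : ℕ) →
                   iterate f x n ≡ List.tabulate (λ (i : Fin n) → fold x f (toℕ i))
iterate≡tabulate f x zero    = refl
iterate≡tabulate f x (suc n) = cong (x ∷_)
  (trans (iterate≡tabulate f (f x) n) (List.tabulate-cong (λ i → fold-suc f x (toℕ i))))

Orbit : Permutation′ n → Fin n → Fin n → Set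
Orbit π x v = ∃ λ j → fold x (π ⟨$⟩ʳ_) j ≡ v

module _ (π : Permutation′ n) where
  private
    f = π ⟨$⟩ʳ_

  orbit-refl : ∀ {x} → Orbit π x x
  orbit-refl = 0 , refl

  orbit-trans : ∀ {x y z} → Orbit π x y → Orbit π y z → Orbit π x z
  orbit-trans {x} (i , refl) (j , refl) = j + i , fold-+ x f j

  fold-cancel : ∀ {x y} i → fold x f i ≡ fold y f i → x ≡ y
  fold-cancel zero    eq = eq
  fold-cancel (suc i) eq = fold-cancel i (⟨$⟩ʳ-injective π eq)

  -- The `i` steps common to both sides cancel by injectivity. Writing the period as `suc d` makes
  -- it positive.
  period : ∀ {x i j} → i < j → fold x f i ≡ fold x f j → ∃ λ d → suc d + i ≡ j × fold x f (suc d) ≡ x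
  period {x} {i} {j} i<j eq =
    d , d+i , sym (fold-cancel i (trans eq (trans (cong (fold x f) (sym i+d)) (fold-+ x f i))))
    where
    d = j ∸ suc i
    d+i : suc d + i ≡ j
    d+i = trans (sym (ℕₚ.+-suc d i)) (ℕₚ.m∸n+n≡m i<j)
    i+d : i + suc d ≡ j
    i+d = trans (ℕₚ.+-comm i (suc d)) d+i

  -- Two of the iterates with exponents `0` to `n` coincide; the difference of their exponents is a
  -- period of at most `n`.
  returns : ∀ x → ∃ λ d → d < n × fold x f (suc d) ≡ x
  returns x with pigeonhole (ℕₚ.n<1+n n) (λ i → fold x f (toℕ i))
  ... | i , j , i<j , eq with period i<j eq
  ... | d , d+i≡j , d-period = d ,
        ℕₚ.≤-trans (ℕₚ.m≤m+n (suc d) (toℕ i)) (subst (_≤ n) (sym d+i≡j) (ℕₚ.≤-pred (toℕ<n j))) ,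
        d-period

  -- `Orbit` allows forward steps only; a single step is undone by going the rest of the way round
  -- the cycle.
  orbit-sym : ∀ {x y} → Orbit π x y → Orbit π y x
  orbit-sym (zero  , refl) = orbit-refl
  orbit-sym {x} (suc j , refl) = orbit-trans back (orbit-sym (j , refl))
    where
    z = fold x f j
    back : Orbit π (f z) z
    back with returns z
    ... | d , _ , eq = d , trans (fold-suc f z d) eq

  module _ {x : Fin n} (full : ∀ v → Orbit π x v) where
    -- Exponents can be reduced modulo a period, so distinct points have distinct remainders below
    -- `suc d`, and the orbit of `x` contains all `n` points.
    n≤period : ∀ d → fold x f (suc d) ≡ x → n ≤ suc d
    n≤period d eq = injective⇒≤ {f = λ v → fromℕ< (m%n<n (index v) (suc d))} λ {u} {v} eq′ →
      trans (sym (reduce u)) (trans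
        (cong (fold x f) (fromℕ<-injective _ _ (m%n<n (index u) (suc d)) (m%n<n (index v) (suc d)) eq′))
        (reduce v))
      where
      index = λ v → proj₁ (full v)

      multiple : ∀ q → fold x f (q * suc d) ≡ x
      multiple zero    = refl
      multiple (suc q) = trans (fold-+ x f (suc d)) (trans (cong (λ z → fold z f (suc d)) (multiple q)) eq)

      reduce : ∀ v → fold x f (index v % suc d) ≡ v
      reduce v = trans (cong (λ z → fold z f (index v % suc d)) (sym (multiple (index v / suc d))))
        (trans (sym (fold-+ x f (index v % suc d)))
        (trans (cong (fold x f) (sym (m≡m%n+[m/n]*n (index v) (suc d)))) (proj₂ (full v))))

    fold-period : fold x f n ≡ x
    fold-period with returns x
    ... | d , d<n , eq = subst (λ k → fold x f k ≡ x) (ℕₚ.≤-antisym d<n (n≤period d eq)) eq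

    fold-distinct : ∀ {i j : Fin n} → i Fin.< j → fold x f (toℕ i) ≢ fold x f (toℕ j)
    fold-distinct {i} {j} i<j eq with period i<j eq
    ... | d , d+i≡j , d-period = ℕₚ.<⇒≱
      (ℕₚ.≤-<-trans (ℕₚ.m≤m+n (suc d) (toℕ i)) (subst (_< n) (sym d+i≡j) (toℕ<n j)))
      (n≤period d d-period)

    fold-injective : Injective _≡_ _≡_ (λ (i : Fin n) → fold x f (toℕ i))
    fold-injective {i} {j} eq with <-cmp i j
    ... | tri≈ _ i≡j _ = i≡j
    ... | tri< i<j _ _ = contradiction eq (fold-distinct i<j)
    ... | tri> _ _ j<i = contradiction (sym eq) (fold-distinct j<i)

    cycleFrom-unique : Unique (cycleFrom π x)
    cycleFrom-unique = subst Unique (sym (iterate≡tabulate f x n)) (Unique.tabulate⁺ fold-injective)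

    cycleFrom-complete : ∀ v → v ∈ cycleFrom π x
    cycleFrom-complete v with injective⇒onto fold-injective v
    ... | i , refl = subst (fold x f (toℕ i) ∈_) (sym (iterate≡tabulate f x n)) (∈-tabulate⁺ i)

-- Products of transpositions and the dual

adj-sym : (e : EdgeLabeled n L) {u v : Fin n} → Adj e u v → Adj e v u
adj-sym e (k , j) = k , joins-sym (e k) j

orbit-⊆ : (π ρ : Permutation′ n) → (∀ z → Orbit ρ z (π ⟨$⟩ʳ z)) → ∀ {u v} → Orbit π u v → Orbit ρ u v
orbit-⊆ π ρ step (zero  , refl) = orbit-refl ρ
orbit-⊆ π ρ step (suc j , refl) = orbit-trans ρ (orbit-⊆ π ρ step (j , refl)) (step _)

-- Multiplying by the transposition of two points in different orbits merges
-- the two orbits and changes no other.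
prod-orbit : (ts : Vec (Transposition n) L) →
             (∀ k → ¬ Star (Without (labeledGraph ts) k) (lo (lookup ts k)) (hi (lookup ts k))) →
             ∀ k → Orbit (prod ts) (lo (lookup ts k)) (hi (lookup ts k))
prod-orbit {n} (t ∷ ts) forest = λ where
    zero    → x—y
    (suc k) → orbit-⊆ τ σ τ⊆σ (prod-orbit ts forest′ k)
  where
  x = lo t
  y = hi t
  τ = prod ts
  σ = prod (t ∷ ts)
  R = Adj (labeledGraph ts)

  forest′ : ∀ k → ¬ Star (Without (labeledGraph ts) k) (lo (lookup ts k)) (hi (lookup ts k))
  forest′ k = forest (suc k) ∘ gmap id λ (k′ , ne , j) → suc k′ , (λ { refl → ne refl }) , j

  apart : ¬ Star R x y
  apart = forest zero ∘ gmap id λ (k , j) → suc k , (λ ()) , j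

  -- Follow `τ` from `z` to `y`. The route stays in the component of `z` in the graph of `ts`, so it
  -- misses `x`, and `σ` agrees with `τ` until `y` is reached.
  hit : ∀ j {z} → ¬ Star R x z → fold z (τ ⟨$⟩ʳ_) j ≡ y → Orbit σ z y
  hit zero    _   refl = orbit-refl σ
  hit (suc j) {z} x≁z eq with z ≟ y
  ... | yes refl = orbit-refl σ
  ... | no z≢y = orbit-trans σ
          (1 , cong (τ ⟨$⟩ʳ_) (transpose-at₃ x y (λ { refl → x≁z ε }) z≢y))
          (hit j (λ w → x≁z (w ◅◅ reverse (adj-sym (labeledGraph ts)) (Joins-prod ts z)))
                 (trans (fold-suc (τ ⟨$⟩ʳ_) z j) eq))

  x→τy : Orbit σ x (τ ⟨$⟩ʳ y)
  x→τy = 1 , cong (τ ⟨$⟩ʳ_) (transpose-at₁ x y refl)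

  -- `σ` jumps from `x` to `τ y`, and the `τ`-cycle of `y` then leads back to `y`.
  x—y : Orbit σ x y
  x—y with returns τ y
  ... | d , _ , eq = orbit-trans σ x→τy
        (hit d (λ w → apart (w ◅◅ reverse (adj-sym (labeledGraph ts)) (Joins-prod ts y)))
               (trans (fold-suc (τ ⟨$⟩ʳ_) y d) eq))

  -- At the two exceptional points `σ` sends `y` to `τ x` and `x` to `τ y`; as `x` and `y` now share
  -- an orbit, the steps of `τ` from them stay within it.
  τ⊆σ : ∀ z → Orbit σ z (τ ⟨$⟩ʳ z)
  τ⊆σ z with z ≟ x | z ≟ y
  ... | yes refl | _        = orbit-trans σ x—y (1 , cong (τ ⟨$⟩ʳ_) (transpose-at₂ x y (lo≢hi t ∘ sym) refl))
  ... | no _     | yes refl = orbit-trans σ (orbit-sym σ x—y) x→τy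
  ... | no z≢x   | no z≢y   = 1 , cong (τ ⟨$⟩ʳ_) (transpose-at₃ x y z≢x z≢y)

-- In a tree every edge is a bridge, so `prod-orbit` puts its ends into one orbit, and walks chain
-- these together.
prod-transitive : (ts : Vec (Transposition (suc m)) m) → (∀ u v → Star (Adj (labeledGraph ts)) u v) →
                  ∀ u v → Orbit (prod ts) u v
prod-transitive ts conn u v = go (conn u v)
  where
  σ = prod ts

  edge : ∀ k → Orbit σ (lo (lookup ts k)) (hi (lookup ts k))
  edge = prod-orbit ts λ k → bridge (labeledGraph ts) conn k (inj₁ (refl , refl))

  go : ∀ {u v} → Star (Adj (labeledGraph ts)) u v → Orbit σ u v
  go ε = orbit-refl σ
  go ((k , inj₁ (refl , refl)) ◅ w) = orbit-trans σ (edge k) (go w)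
  go ((k , inj₂ (refl , refl)) ◅ w) = orbit-trans σ (orbit-sym σ (edge k)) (go w)

transposition-joins : (x y : Fin n) (x≢y : x ≢ y) → Joins (ends (transposition x y x≢y)) x y
transposition-joins x y x≢y with <-cmp x y
... | tri< _ _ _   = inj₁ (refl , refl)
... | tri≈ _ x≡y _ = contradiction x≡y x≢y
... | tri> _ _ _   = inj₂ (refl , refl)

-- Crossed ends would order the same two points both ways.
joins-ends-injective : {t t′ : Transposition n} {x y : Fin n} →
                       Joins (ends t) x y → Joins (ends t′) x y → t ≡ t′
joins-ends-injective (inj₁ (refl , refl)) (inj₁ (refl , refl)) = refl
joins-ends-injective (inj₂ (refl , refl)) (inj₂ (refl , refl)) = refl
joins-ends-injective {t = mkTransposition _ _ p} {mkTransposition _ _ q} (inj₁ (refl , refl)) (inj₂ (refl , refl)) =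
  ⊥-elim-irr (<-asym p q)
joins-ends-injective {t = mkTransposition _ _ p} {mkTransposition _ _ q} (inj₂ (refl , refl)) (inj₁ (refl , refl)) =
  ⊥-elim-irr (<-asym p q)

joins-transfer : {e e′ : Fin n × Fin n} {a b u v : Fin n} →
                 Joins e a b → Joins e′ a b → Joins e u v → Joins e′ u v
joins-transfer {e = e} {e′} j j′ j″ with joins-same e j j″
... | inj₁ (refl , refl) = j′
... | inj₂ (refl , refl) = joins-sym e′ j′

joins-map : (f : Fin m → Fin n) {a b u v : Fin m} → Joins (a , b) u v → Joins (f a , f b) (f u) (f v)
joins-map f (inj₁ (refl , refl)) = inj₁ (refl , refl)
joins-map f (inj₂ (refl , refl)) = inj₂ (refl , refl)

above-joins : (A : Permutation′ n) (t : Transposition n) →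
              Joins (ends (above A t)) (A ⟨$⟩ˡ lo t) (A ⟨$⟩ˡ hi t)
above-joins A t = transposition-joins _ _ _

above-inverse : (A : Permutation′ n) (t : Transposition n) → above (flip A) (above A t) ≡ t
above-inverse A t = joins-ends-injective
  (subst₂ (Joins (ends (above (flip A) (above A t)))) (inverseʳ A) (inverseʳ A)
    (joins-transfer (inj₁ (refl , refl)) (transposition-joins _ _ _)
                    (joins-map (A ⟨$⟩ʳ_) (above-joins A t))))
  (inj₁ (refl , refl))

-- The current assignment `A` is known at each step, so `above-inverse` recovers the first
-- transposition and, with it, the next assignment.
dualFrom-injective : (A : Permutation′ n) {ts us : Vec (Transposition n) L} →
                     dualFrom A ts ≡ dualFrom A us → ts ≡ us
dualFrom-injective A {[]}     {[]}     _  = refl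
dualFrom-injective A {t ∷ ts} {u ∷ us} eq with ∷-injective eq
... | eq₁ , eq₂ with trans (sym (above-inverse A t)) (trans (cong (above (flip A)) eq₁) (above-inverse A u))
... | refl = cong (t ∷_) (dualFrom-injective (A ∘ₚ ⟦ t ⟧ₜ) eq₂)

dualFrom-surjective : (A : Permutation′ n) (ts : Vec (Transposition n) L) → ∃ λ us → dualFrom A us ≡ ts
dualFrom-surjective A []       = [] , refl
dualFrom-surjective A (t ∷ ts) with dualFrom-surjective (A ∘ₚ ⟦ above (flip A) t ⟧ₜ) ts
... | us , eq = above (flip A) t ∷ us , cong₂ _∷_ (above-inverse (flip A) t) eq

D-surjective : (s′ : F↑ m) → ∃ λ (s : F↓ m) → proj₁ (D s) ≡ proj₁ s′
D-surjective (ts , eq) with dualFrom-surjective Perm.id ts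
... | us , refl = (us , desc) , refl
  where
  desc : prod us Perm.≈ descending
  -- The dual has product `up`, which is thus the inverse of `prod us`: it takes the image of `i`
  -- under `prod us` back to `i`, and `down` undoes `up`.
  desc i = trans (sym (down-up (prod us ⟨$⟩ʳ i))) (cong down
             (trans (sym (eq _)) (trans (prod-dualFrom Perm.id us _) (inverseˡ (prod us)))))

-- Moved past `A`, the dual factor `above A t` becomes `t` and cancels against the `t` in the next
-- assignment `A ∘ₚ ⟦ t ⟧ₜ`. Only the missing factor leaves its transposition uncancelled.
prod-removeAt-dualFrom : (A : Permutation′ n) (ts : Vec (Transposition n) (suc L)) (k : Fin (suc L)) →
  prod (removeAt (dualFrom A ts) k) Perm.≈ A ∘ₚ ⟦ lookup ts k ⟧ₜ ∘ₚ flip (prod ts) ∘ₚ flip A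
prod-removeAt-dualFrom A (t ∷ ts)       zero    i = prod-dualFrom (A ∘ₚ ⟦ t ⟧ₜ) ts i
prod-removeAt-dualFrom A (t ∷ ts@(_ ∷ _)) (suc k) i = trans
  (prod-removeAt-dualFrom (A ∘ₚ ⟦ t ⟧ₜ) ts k (⟦ above A t ⟧ₜ ⟨$⟩ʳ i))
  (cong (λ z → A ⟨$⟩ˡ (⟦ t ⟧ₜ ⟨$⟩ˡ (prod ts ⟨$⟩ˡ (⟦ lookup ts k ⟧ₜ ⟨$⟩ʳ z))))
        (trans (cong (⟦ t ⟧ₜ ⟨$⟩ʳ_) (conjugate A t i)) (⟦⟧ₜ-involutive t (A ⟨$⟩ʳ i))))

removeAt-adj : (ts : Vec (Transposition n) (suc L)) (k : Fin (suc L)) {u v : Fin n} →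
               Adj (labeledGraph (removeAt ts k)) u v → Without (labeledGraph ts) k u v
removeAt-adj ts k {u} {v} (j , joins) = punchIn k j , (punchInᵢ≢i k j ∘ sym) ,
  subst (λ t → Joins (ends t) u v)
    (trans (cong (lookup (removeAt ts k))
             (sym (trans (punchOut-cong k {i≢j = punchInᵢ≢i k j ∘ sym} refl) (punchOut-punchIn k))))
           (removeAt-punchOut ts _)) joins

-- Relabeled trees

joins-reflect : (f : Fin m → Fin n) → Injective _≡_ _≡_ f → {a b u v : Fin m} →
                Joins (f a , f b) (f u) (f v) → Joins (a , b) u v
joins-reflect f inj = Sum.map (Product.map inj inj) (Product.map inj inj)

lookup-injective : {A : Set} {xs ys : Vec A n} → (∀ i → lookup xs i ≡ lookup ys i) → xs ≡ ys
lookup-injective {xs = xs} {ys} eq =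
  trans (sym (tabulate∘lookup xs)) (trans (tabulate-cong eq) (tabulate∘lookup ys))

vertices-gmap : {R : Rel (Fin m) 0ℓ} {R′ : Rel (Fin n) 0ℓ} (f : Fin m → Fin n)
                (g : ∀ {u v} → R u v → R′ (f u) (f v)) {u v : Fin m} (p : Star R u v) →
                vertices {R = R′} (gmap f g p) ≡ List.map f (vertices p)
vertices-gmap f g ε       = refl
vertices-gmap f g (_ ◅ p) = cong (f _ ∷_) (vertices-gmap f g p)

simple-gmap : {R : Rel (Fin m) 0ℓ} {R′ : Rel (Fin n) 0ℓ} {f : Fin m → Fin n} → Injective _≡_ _≡_ f →
              (g : ∀ {u v} → R u v → R′ (f u) (f v)) {u v : Fin m} (p : Star R u v) →
              Simple p → Simple {R = R′} (gmap f g p)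
simple-gmap {f = f} inj g p s = subst Unique (sym (vertices-gmap f g p)) (Unique.map⁺ inj s)

firstEdge-map : {e : EdgeLabeled m L} {e′ : EdgeLabeled n L} {f : Fin m → Fin n} → Injective _≡_ _≡_ f →
                (∀ k {u v} → Joins (e k) u v → Joins (e′ k) (f u) (f v)) →
                ∀ {r v k} → FirstEdge e r v k → FirstEdge e′ (f r) (f v) k
firstEdge-map inj g {k = k} (u , j , p , s) =
  _ , g k j , gmap _ (λ (k , j) → k , g k j) p , simple-gmap inj (λ (k , j) → k , g k j) ((k , j) ◅ p) s

-- The normal form behind `S`: up to the shift `suc`, an edge label names the end farther from the
-- root, so erasing the labels loses nothing.
Rooted : EdgeLabeled (suc m) m → Set
Rooted e = ∀ k → FirstEdge e zero (suc k) k

-- A path from `suc k` to the root that starts with edge `k` of `e` is also a path in `e′`, where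
-- uniqueness of first edges forces the same label.
rooted-joins : {e e′ : EdgeLabeled (suc m) m} → (∀ u v → Star (Adj e′) u v) → Rooted e → Rooted e′ →
               (∀ {u v} → Adj e u v → Adj e′ u v) →
               ∀ k {u v} → Joins (e k) u v → Joins (e′ k) u v
rooted-joins {e′ = e′} conn root root′ e⊆e′ k with root k
... | u , j , p , s with e⊆e′ (k , j)
...   | k′ , j′ with firstEdge-unique e′ conn
                       (u , j′ , gmap id e⊆e′ p , simple-gmap id e⊆e′ ((k , j) ◅ p) s) (root′ k)
...     | refl = joins-transfer j j′

transpose-map : {f : Fin m → Fin n} → Injective _≡_ _≡_ f → ∀ x y i →
                f (PC.transpose x y i) ≡ PC.transpose (f x) (f y) (f i)
transpose-map {f = f} inj x y i = go (i ≟ x) (i ≟ y)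
  where
  go : Dec (i ≡ x) → Dec (i ≡ y) → f (PC.transpose x y i) ≡ PC.transpose (f x) (f y) (f i)
  go (yes p) _       = trans (cong f (transpose-at₁ x y p)) (sym (transpose-at₁ (f x) (f y) (cong f p)))
  go (no ¬p) (yes q) = trans (cong f (transpose-at₂ x y ¬p q)) (sym (transpose-at₂ (f x) (f y) (¬p ∘ inj) (cong f q)))
  go (no ¬p) (no ¬q) = trans (cong f (transpose-at₃ x y ¬p ¬q)) (sym (transpose-at₃ (f x) (f y) (¬p ∘ inj) (¬q ∘ inj)))

transpose-joins : {a b c d : Fin n} → Joins (a , b) c d → ∀ i → PC.transpose a b i ≡ PC.transpose c d i
transpose-joins         (inj₁ (refl , refl)) i = refl
transpose-joins {c = c} {d} (inj₂ (refl , refl)) i = transpose-comm d c i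

-- An injection carries the action of a transposition to that of its image. Both sequences are
-- compared inside the target, and through `Joins`, because a renamed pair need not stay in
-- increasing order.
prod-conjugate : {f g : Fin m → Fin n} → Injective _≡_ _≡_ f → Injective _≡_ _≡_ g →
                 (ts us : Vec (Transposition m) L) →
                 (∀ k → Joins (f (lo (lookup ts k)) , f (hi (lookup ts k)))
                              (g (lo (lookup us k))) (g (hi (lookup us k)))) →
                 ∀ {i j} → f i ≡ g j → f (prod ts ⟨$⟩ʳ i) ≡ g (prod us ⟨$⟩ʳ j)
prod-conjugate f-inj g-inj []       []       _  eq = eq
prod-conjugate {f = f} {g} f-inj g-inj (t ∷ ts) (u ∷ us) js {i} {j} eq =
  prod-conjugate f-inj g-inj ts us (js ∘ suc)
    (trans (transpose-map f-inj (lo t) (hi t) i)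
    (trans (transpose-joins (js zero) (f i))
    (trans (cong (PC.transpose (g (lo u)) (g (hi u))) eq)
           (sym (transpose-map g-inj (lo u) (hi u) j)))))

-- Congruence and injectivity of `S`

module _ (s : F↑ m) where
  private
    e = labeledGraph (proj₁ s)

  relabel-firstEdge : ∀ {i k} → FirstEdge e zero (suc i) k → relabel s (suc i) ≡ suc k
  relabel-firstEdge fe = cong suc (firstEdge-unique e (factorization-connected s) (proj₂ (rootEdge s _)) fe)

  relabeled-rooted : Rooted (relabeled s)
  relabeled-rooted k with injective⇒onto (relabel-injective s) (suc k)
  ... | suc i , refl = firstEdge-map (relabel-injective s) (relabel-Joins s) (proj₂ (rootEdge s i))

-- The paths chosen by `rootEdge` depend on the proof about the product, which may differ for equal
-- sequences; uniqueness of first edges makes the new names independent of it.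
S-congruent : (s s′ : F↑ m) → proj₁ s ≡ proj₁ s′ → S s ≈T S s′
S-congruent s s′ refl u v = mk⇔ (⊆ s s′ refl same) (⊆ s′ s refl (sym ∘ same))
  where
  same : ∀ i → relabel s i ≡ relabel s′ i
  same zero    = refl
  same (suc i) = relabel-firstEdge s (proj₂ (rootEdge s′ i))

  ⊆ : (s s′ : F↑ _) → proj₁ s ≡ proj₁ s′ → (∀ i → relabel s i ≡ relabel s′ i) →
      Adj (relabeled s) u v → Adj (relabeled s′) u v
  ⊆ s s′ refl eq (k , j) = k , subst₂ (λ a b → Joins (a , b) u v) (eq _) (eq _) j

-- The rooted tree gives back the relabeled edges, label by label, and their product gives back the
-- relabeling.
S-injective : (s s′ : F↑ m) → S s ≈T S s′ → proj₁ s ≡ proj₁ s′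
S-injective s s′ eq = lookup-injective λ k →
  joins-ends-injective (joins-reflect (relabel s) (relabel-injective s)
      (subst₂ (Joins (relabeled s k)) (sym (same _)) (sym (same _)) (edge k)))
    (inj₁ (refl , refl))
  where
  edge : ∀ k → Joins (relabeled s k) (relabel s′ (lo (lookup (proj₁ s′) k)))
                                     (relabel s′ (hi (lookup (proj₁ s′) k)))
  edge k = rooted-joins (relabeled-connected s) (relabeled-rooted s′) (relabeled-rooted s)
             (Equivalence.from (eq _ _)) k (inj₁ (refl , refl))

  -- Both relabelings fix `zero` and carry `ascending` to the product of the same relabeled
  -- sequence, so agreement at `inject₁ i` passes on to `suc i`.
  same : ∀ i → relabel s i ≡ relabel s′ i
  same = <-weakInduction _ refl λ i eqᵢ → trans (sym (next s i)) (trans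
      (prod-conjugate (relabel-injective s) (relabel-injective s′) (proj₁ s) (proj₁ s′) edge eqᵢ)
      (next s′ i))
    where
    next : (s : F↑ _) → ∀ i → relabel s (prod (proj₁ s) ⟨$⟩ʳ inject₁ i) ≡ relabel s (suc i)
    next s i = cong (relabel s) (trans (proj₂ s (inject₁ i)) (up-inject₁ i))

-- Renaming a rooted sequence along its product

fromInjective : (f : Fin n → Fin n) → Injective _≡_ _≡_ f → Permutation′ n
fromInjective f inj = permutation f (λ v → proj₁ (injective⇒onto inj v))
  (λ v → proj₂ (injective⇒onto inj v)) (λ v → inj (proj₂ (injective⇒onto inj (f v))))

prod-map-above : (ρ : Permutation′ n) (ts : Vec (Transposition n) L) (i : Fin n) →
                 ρ ⟨$⟩ʳ (prod (Vec.map (above ρ) ts) ⟨$⟩ʳ i) ≡ prod ts ⟨$⟩ʳ (ρ ⟨$⟩ʳ i)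
prod-map-above ρ []       i = refl
prod-map-above ρ (t ∷ ts) i = trans (prod-map-above ρ ts _) (cong (prod ts ⟨$⟩ʳ_) (conjugate ρ t i))

-- A rooted sequence becomes an element of F↑ once its vertices are renamed
-- along its product.
module _ (ts : Vec (Transposition (suc m)) m) (root : Rooted (labeledGraph ts))
         (ρ : Permutation′ (suc m)) (ρ-zero : ρ ⟨$⟩ʳ zero ≡ zero)
         (ρ-up : ∀ i → ρ ⟨$⟩ʳ up i ≡ prod ts ⟨$⟩ʳ (ρ ⟨$⟩ʳ i)) where
  renamed : Vec (Transposition (suc m)) m
  renamed = Vec.map (above ρ) ts

  renamed-F↑ : F↑ m
  renamed-F↑ = renamed , λ i → ⟨$⟩ʳ-injective ρ (trans (prod-map-above ρ ts i) (sym (ρ-up i)))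

  renamed-joins : ∀ k {u v} → Joins (ends (lookup ts k)) u v →
                  Joins (ends (lookup renamed k)) (ρ ⟨$⟩ˡ u) (ρ ⟨$⟩ˡ v)
  renamed-joins k j = subst (λ t → Joins (ends t) _ _) (sym (lookup-map k (above ρ) ts))
    (joins-transfer (inj₁ (refl , refl)) (above-joins ρ (lookup ts k)) (joins-map (ρ ⟨$⟩ˡ_) j))

  ρ⁻¹-zero : ρ ⟨$⟩ˡ zero ≡ zero
  ρ⁻¹-zero = trans (cong (ρ ⟨$⟩ˡ_) (sym ρ-zero)) (inverseˡ ρ)

  -- The inverse of `ρ` carries a path from `suc k` to the root with first edge `k` to such a path
  -- in the renamed tree; by uniqueness `relabel` restores the name `suc k`.
  relabel-ρ⁻¹ : ∀ v → relabel renamed-F↑ (ρ ⟨$⟩ˡ v) ≡ v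
  relabel-ρ⁻¹ zero    = cong (relabel renamed-F↑) ρ⁻¹-zero
  relabel-ρ⁻¹ (suc k) = go (ρ ⟨$⟩ˡ suc k) refl
    where
    go : ∀ i → ρ ⟨$⟩ˡ suc k ≡ i → relabel renamed-F↑ (ρ ⟨$⟩ˡ suc k) ≡ suc k
    go zero eq with () ← ⟨$⟩ˡ-injective ρ (trans eq (sym ρ⁻¹-zero))
    go (suc i) eq = trans (cong (relabel renamed-F↑) eq) (relabel-firstEdge renamed-F↑
      (subst₂ (λ r v → FirstEdge (labeledGraph renamed) r v k) ρ⁻¹-zero eq
        (firstEdge-map (⟨$⟩ˡ-injective ρ) renamed-joins (root k))))

  relabeled-renamed : ∀ k {u v} → Joins (ends (lookup ts k)) u v → Joins (relabeled renamed-F↑ k) u v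
  relabeled-renamed k j = subst₂ (Joins (relabeled renamed-F↑ k)) (relabel-ρ⁻¹ _) (relabel-ρ⁻¹ _)
    (relabel-Joins renamed-F↑ k (renamed-joins k j))

  S-renamed : ∀ {u v} → Adj (relabeled renamed-F↑) u v ⇔ Adj (labeledGraph ts) u v
  S-renamed = mk⇔
    (λ (k , j) → k , joins-transfer (relabeled-renamed k (inj₁ (refl , refl))) (inj₁ (refl , refl)) j)
    (λ (k , j) → k , relabeled-renamed k j)

module _ (ts : Vec (Transposition (suc m)) m) (conn : ∀ u v → Star (Adj (labeledGraph ts)) u v) where
  private
    σ    = prod ts
    full = prod-transitive ts conn zero

  -- Sends `i` to the `i`-th iterate of `σ` at `zero`. No other renaming fixes `zero` and carries
  -- `ascending` to `σ`.
  traversal : Permutation′ (suc m)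
  traversal = fromInjective _ (fold-injective σ full)

  traversal-up : ∀ i → traversal ⟨$⟩ʳ up i ≡ σ ⟨$⟩ʳ (traversal ⟨$⟩ʳ i)
  traversal-up i = go (view i)
    where
    go : ∀ {i} (v : View i) → traversal ⟨$⟩ʳ upView v ≡ σ ⟨$⟩ʳ (traversal ⟨$⟩ʳ i)
    -- The wrap-around: the last index is `m`, and one more step completes the `suc m` steps after
    -- which `σ` is back at `zero`.
    go ‵fromℕ            = sym (trans (cong (λ j → σ ⟨$⟩ʳ fold zero (σ ⟨$⟩ʳ_) j) (toℕ-fromℕ m))
                                      (fold-period σ full))
    go (‵inj₁ {i = i} _) = cong (λ j → σ ⟨$⟩ʳ fold zero (σ ⟨$⟩ʳ_) j) (sym (toℕ-inject₁ i))

  rooted⇒S : Rooted (labeledGraph ts) → ∃ λ s → ∀ {u v} → Adj (relabeled s) u v ⇔ Adj (labeledGraph ts) u v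
  rooted⇒S root = renamed-F↑ ts root traversal refl traversal-up , S-renamed ts root traversal refl traversal-up

-- Rooted labeling of an arbitrary tree

module _ (T : Tree (suc m)) where
  open Tree T

  -- Made simple, a walk around the edge would be empty, a single edge or longer: that is, a loop at
  -- `u`, the deleted edge itself, or a path that the edge closes to a cycle.
  ~-bridge : ∀ {u v} → u ~ v → ¬ Star (delete (u , v)) u v
  ~-bridge {u} {v} u~v w with erase w
  ... | ε , _ = ~-irrefl u~v
  ... | (_ , not) ◅ ε , _ = not (inj₁ (refl , refl))
  ... | q@(_ ◅ _ ◅ q′) , s = acyclic (v , u , ~-sym u~v , gmap id proj₁ q ,
          simple-gmap id proj₁ q s , s≤s (s≤s (nonempty (gmap id proj₁ q′))))
    where
    nonempty : ∀ {a b} (p : Star _~_ a b) → 1 ≤ length (vertices p)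
    nonempty ε       = s≤s z≤n
    nonempty (_ ◅ _) = s≤s z≤n

  delete-sym : ∀ e {a b} → delete e a b → delete e b a
  delete-sym e (r , not) = ~-sym r , not ∘ joins-sym e

  delete-swap : ∀ {u v a b} → delete (u , v) a b → delete (v , u) a b
  delete-swap (r , not) = r , not ∘ swap

  avoid : ∀ {u v a b} (p : Star _~_ a b) → All (u ≢_) (vertices p) → Star (delete (u , v)) a b
  avoid ε       _        = ε
  avoid (r ◅ p) (ne ∷ nes) =
    (r , λ { (inj₁ (a≡u , _)) → ne (sym a≡u)
           ; (inj₂ (_ , b≡u)) → All.lookup nes (head∈ p) (sym b≡u) }) ◅ avoid p nes

  -- Cases on the last use of the edge uv on the walk.
  lastUse : ∀ u v {a r} → Star _~_ a r →
            Star (delete (u , v)) a r ⊎ (Star (delete (u , v)) u r ⊎ Star (delete (u , v)) v r)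
  lastUse u v ε = inj₁ ε
  lastUse u v (_◅_ {i = a} {j = b} r p) with lastUse u v p | joins? (u , v) a b
  ... | inj₂ q | _                     = inj₂ q
  ... | inj₁ q | no not                = inj₁ ((r , not) ◅ q)
  ... | inj₁ q | yes (inj₁ (_ , refl)) = inj₂ (inj₂ q)
  ... | inj₁ q | yes (inj₂ (_ , refl)) = inj₂ (inj₁ q)

  record Parent (v : Fin (suc m)) : Set where
    field
      parent : Fin (suc m)
      edge   : v ~ parent
      path   : Star _~_ parent zero
      simple : Simple {R = _~_} (edge ◅ path)

  parentOf : ∀ k → Parent (suc k)
  parentOf k with erase (connected (suc k) zero)
  ... | edge ◅ path , simple = record { edge = edge ; path = path ; simple = simple }

  parentEdge : EdgeLabeled (suc m) m
  parentEdge k = suc k , Parent.parent (parentOf k)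

  -- The walk `w` puts the root on the side of `v`. If the parent of `u` were not `v`, going through
  -- it to the root and back along `w` would bypass the bridge; if `u` were the root, `w` alone
  -- would.
  toward-root : ∀ {u v} → u ~ v → Star (delete (u , v)) v zero → Adj parentEdge u v
  toward-root {zero}  u~v w = contradiction (reverse (delete-sym _) w) (~-bridge u~v)
  toward-root {suc k} {v} u~v w with parentOf k in eq
  ... | record { parent = p ; edge = edge ; path = path ; simple = u∉ ∷ _ } with p ≟ v
  ... | yes refl = k , inj₁ (refl , sym (cong Parent.parent eq))
  ... | no p≢v   = contradiction
        ((edge , λ { (inj₁ (_ , p≡v)) → p≢v p≡v ; (inj₂ (u≡v , _)) → ~-irrefl (subst (suc k ~_) (sym u≡v) u~v) })
          ◅ avoid path u∉ ◅◅ reverse (delete-sym _) w)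
        (~-bridge u~v)

  -- Once the edge is deleted, one of its ends still reaches the root; the other end is the child.
  ~⇒parentEdge : ∀ {u v} → u ~ v → Adj parentEdge u v
  ~⇒parentEdge {u} {v} u~v with lastUse u v (connected v zero)
  ... | inj₁ w        = toward-root u~v w
  ... | inj₂ (inj₂ w) = toward-root u~v w
  ... | inj₂ (inj₁ w) = adj-sym parentEdge (toward-root (~-sym u~v) (gmap id delete-swap w))

  parentEdge⇒~ : ∀ {u v} → Adj parentEdge u v → u ~ v
  parentEdge⇒~ (k , inj₁ (refl , refl)) = Parent.edge (parentOf k)
  parentEdge⇒~ (k , inj₂ (refl , refl)) = ~-sym (Parent.edge (parentOf k))

  private
    loopless : ∀ k → suc k ≢ Parent.parent (parentOf k)
    loopless k eq = ~-irrefl (subst (suc k ~_) (sym eq) (Parent.edge (parentOf k)))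

  parentSequence : Vec (Transposition (suc m)) m
  parentSequence = tabulate λ k → transposition _ _ (loopless k)

  parentSequence-joins : ∀ k → Joins (ends (lookup parentSequence k)) (suc k) (Parent.parent (parentOf k))
  parentSequence-joins k = subst (λ t → Joins (ends t) (suc k) (Parent.parent (parentOf k)))
    (sym (lookup∘tabulate _ k)) (transposition-joins _ _ (loopless k))

  ~⇒parentSequence : ∀ {u v} → u ~ v → Adj (labeledGraph parentSequence) u v
  ~⇒parentSequence r with ~⇒parentEdge r
  ... | k , j = k , joins-transfer (inj₁ (refl , refl)) (parentSequence-joins k) j

  parentSequence⇒~ : ∀ {u v} → Adj (labeledGraph parentSequence) u v → u ~ v
  parentSequence⇒~ (k , j) = parentEdge⇒~ (k , joins-transfer (parentSequence-joins k) (inj₁ (refl , refl)) j)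

  parentSequence-rooted : Rooted (labeledGraph parentSequence)
  parentSequence-rooted k = parent , parentSequence-joins k , gmap id ~⇒parentSequence path ,
    simple-gmap id ~⇒parentSequence (edge ◅ path) simple
    where open Parent (parentOf k)

  S-surjective : ∃ λ s → S s ≈T T
  S-surjective = Product.map₂ matches
    (rooted⇒S parentSequence (λ u v → gmap id ~⇒parentSequence (connected u v)) parentSequence-rooted)
    where
    matches : ∀ {s} → (∀ {u v} → Adj (relabeled s) u v ⇔ Adj (labeledGraph parentSequence) u v) → S s ≈T T
    matches eq u v = mk⇔ (parentSequence⇒~ ∘ Equivalence.to eq) (Equivalence.from eq ∘ ~⇒parentSequence)

-- Indices

unique-complete⇒↭ : {A : Set} {xs ys : List A} → Unique xs → Unique ys →
                    (∀ {z} → z ∈ xs → z ∈ ys) → (∀ {z} → z ∈ ys → z ∈ xs) → xs ↭ ys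
unique-complete⇒↭ uxs uys to from = ∼bag⇒↭ (unique∧set⇒bag uxs uys (mk⇔ to from))

length-filter-++ : {A : Set} {P : U.Pred A 0ℓ} (P? : U.Decidable P) {xs ys zs : List A} → zs ↭ xs ++ ys →
                   All P xs → All (¬_ ∘ P) ys → length (filter P? zs) ≡ length xs
length-filter-++ P? {xs} {ys} zs↭ pxs ¬pys = trans (↭.↭-length (↭.filter-↭ P? zs↭)) (cong length
  (trans (filter-++ P? xs ys) (trans (cong₂ _++_ (filter-all P? pxs) (filter-none P? ¬pys)) (++-identityʳ xs))))

module _ {W : Rel (Fin n) 0ℓ} (W? : Decidable W) (W-sym : Symmetric W) (W-trans : Transitive W) where
  private
    size = λ u → length (filter (W? u) (allFin n))

  size-class : ∀ {a b u xs ys} → allFin n ↭ xs ++ ys → All (W a) xs → All (W b) ys → W a u → ¬ W u b →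
               size u ≡ length xs
  size-class {u = u} all↭ axs bys au u≁b = length-filter-++ (W? u) all↭
    (All.map (W-trans (W-sym au)) axs) (All.map (λ bz uz → u≁b (W-trans uz (W-sym bz))) bys)

  -- Being unrelated, `u` and `v` fall into different blocks, so each block is a whole class. Which
  -- of them falls into which block stays open, and the minimum does not depend on it.
  size-⊓ : ∀ {a b u v xs ys} → allFin n ↭ xs ++ ys → All (W a) xs → All (W b) ys → ¬ W u v →
           size u ⊓ size v ≡ length xs ⊓ length ys
  size-⊓ {a} {b} {u} {v} {xs} {ys} all↭ axs bys u≁v = go (locate u) (locate v)
    where
    all↭′ : allFin n ↭ ys ++ xs
    all↭′ = ↭-trans all↭ (↭.++-comm xs ys)

    locate : ∀ z → W a z ⊎ W b z
    locate z = Sum.map (All.lookup axs) (All.lookup bys) (∈-++⁻ xs (↭.∈-resp-↭ all↭ (∈-allFin z)))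

    go : W a u ⊎ W b u → W a v ⊎ W b v → size u ⊓ size v ≡ length xs ⊓ length ys
    go (inj₁ au) (inj₁ av) = contradiction (W-trans (W-sym au) av) u≁v
    go (inj₂ bu) (inj₂ bv) = contradiction (W-trans (W-sym bu) bv) u≁v
    go (inj₁ au) (inj₂ bv) = cong₂ _⊓_
      (size-class all↭ axs bys au (λ ub → u≁v (W-trans ub bv)))
      (size-class all↭′ bys axs bv (λ va → u≁v (W-sym (W-trans va au))))
    go (inj₂ bu) (inj₁ av) = trans (cong₂ _⊓_
      (size-class all↭′ bys axs bu (λ ua → u≁v (W-trans ua av)))
      (size-class all↭ axs bys av (λ vb → u≁v (W-sym (W-trans vb bu)))))
      (ℕₚ.⊓-comm (length ys) (length xs))

module _ {R : Rel (Fin n) 0ℓ} (R-refl : Reflexive R) (R-trans : Transitive R)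
         (f : Fin n → Fin n) (x y : Fin n) (step : ∀ a → f a ≢ x → f a ≢ y → R a (f a)) where
  private
    ≢y? = λ z → ¬? (z ≟ y)

  iterate-linked : ∀ N a → All (x ≢_) (iterate f (f a) N) → All (y ≢_) (iterate f (f a) N) →
                   All (R a) (iterate f (f a) N)
  iterate-linked zero    a _          _          = []
  iterate-linked (suc N) a (x∉ ∷ xs∉) (y∉ ∷ ys∉) =
    step′ ∷ All.map (R-trans step′) (iterate-linked N (f a) xs∉ ys∉)
    where
    step′ = step a (≢-sym x∉) (≢-sym y∉)

  takeWhile-linked : ∀ N a → All (x ≢_) (iterate f (f a) N) → All (R a) (takeWhile ≢y? (iterate f (f a) N))
  takeWhile-linked zero    a _          = []
  takeWhile-linked (suc N) a (x∉ ∷ xs∉) with f a ≟ y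
  ... | yes _   = []
  ... | no fa≢y = step′ ∷ All.map (R-trans step′) (takeWhile-linked N (f a) xs∉)
    where
    step′ = step a (≢-sym x∉) fa≢y

  dropWhile-linked : ∀ N a → Unique (iterate f a N) → All (x ≢_) (iterate f a N) →
                     All (R y) (dropWhile ≢y? (iterate f a N))
  dropWhile-linked zero    a _        _          = []
  dropWhile-linked (suc N) a (a∉ ∷ u) (_ ∷ xs∉) with a ≟ y
  -- After `y` the list meets neither `x` nor, being free of repetitions, `y` again, so no link
  -- breaks.
  ... | yes refl = R-refl ∷ iterate-linked N a xs∉ a∉
  ... | no  _    = dropWhile-linked N (f a) u xs∉

  -- Links can break only on arrival at `x` or `y`. As `x` occurs only at the head, the one possible
  -- break is at `y`, exactly where the list is split.
  cycle-linked : ∀ N → x ≢ y → Unique (iterate f x N) →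
                 All (R x) (takeWhile ≢y? (iterate f x N)) × All (R y) (dropWhile ≢y? (iterate f x N))
  cycle-linked zero    _   _        = [] , []
  cycle-linked (suc N) x≢y (x∉ ∷ u) with x ≟ y
  ... | yes x≡y = contradiction x≡y x≢y
  ... | no  _   = R-refl ∷ takeWhile-linked N x x∉ , dropWhile-linked N (f x) u x∉

-- Without its k-th factor, the product of the dual is the inverse of prod ts
-- preceded by the k-th transposition of ts.
dual-linked : (ts : Vec (Transposition n) L) (k : Fin L) (a : Fin n) →
              prod ts ⟨$⟩ʳ a ≢ lo (lookup ts k) → prod ts ⟨$⟩ʳ a ≢ hi (lookup ts k) →
              Star (Without (labeledGraph (dual ts)) k) a (prod ts ⟨$⟩ʳ a)
-- The shortened product takes the image of `a` back to `a`, since the `k`-th transposition fixes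
-- that image; the resulting walk is therefore reversed.
dual-linked {L = suc _} ts k a ≢lo ≢hi = reverse (without-sym _ k) (subst (Star _ _)
  (trans (prod-removeAt-dualFrom Perm.id ts k (prod ts ⟨$⟩ʳ a))
         (trans (cong (prod ts ⟨$⟩ˡ_) (transpose-at₃ _ _ ≢lo ≢hi)) (inverseˡ (prod ts))))
  (gmap id (removeAt-adj (dual ts) k) (Joins-prod (removeAt (dual ts) k) (prod ts ⟨$⟩ʳ a))))

-- Connectivity is available for `F↑`, so transitivity is first obtained for the dual; its product
-- is the inverse of `π` and has the same orbits.
descending-transitive : (s : F↓ m) → ∀ u v → Orbit (prod (proj₁ s)) u v
descending-transitive s u v = orbit-⊆ (prod (dual (proj₁ s))) (prod (proj₁ s)) back
  (prod-transitive (dual (proj₁ s)) (factorization-connected (D s)) u v)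
  where
  π = prod (proj₁ s)

  back : ∀ z → Orbit π z (prod (dual (proj₁ s)) ⟨$⟩ʳ z)
  back z = orbit-sym π (1 , trans (cong (π ⟨$⟩ʳ_) (prod-dualFrom Perm.id (proj₁ s) z)) (inverseʳ π))

lo<hi′ : (t : Transposition n) → lo t Fin.< hi t
lo<hi′ (mkTransposition x y x<y) = recompute (x <? y) x<y

-- Edges of the relabeled tree

module _ (s : F↑ m) where
  open Tree (S s) using (_~_; _~?_; edges; delete)

  -- `edges` lists increasing pairs, while `relabel` need not preserve order, so the ends are sorted
  -- anew.
  treeEdge : Fin m → Transposition (suc m)
  treeEdge k = transposition (relabel s (lo t)) (relabel s (hi t)) (lo≢hi t ∘ relabel-injective s)
    where t = lookup (proj₁ s) k

  treeEdge-joins : ∀ k {u v} → Joins (relabeled s k) u v → Joins (ends (treeEdge k)) u v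
  treeEdge-joins k = joins-transfer (inj₁ (refl , refl)) (transposition-joins _ _ _)

  treeEdge-joins⁻¹ : ∀ k {u v} → Joins (ends (treeEdge k)) u v → Joins (relabeled s k) u v
  treeEdge-joins⁻¹ k = joins-transfer (transposition-joins _ _ _) (inj₁ (refl , refl))

  -- With two labels on the same ends, one edge would bypass the other, which is a bridge.
  treeEdge-injective : ∀ {k k′} → ends (treeEdge k) ≡ ends (treeEdge k′) → k ≡ k′
  treeEdge-injective {k} {k′} eq with k ≟ k′
  ... | yes p = p
  ... | no ¬p = contradiction
    (return (k′ , ¬p , treeEdge-joins⁻¹ k′ (subst (λ e → Joins e (lo t) (hi t)) eq (inj₁ (refl , refl)))))
    (bridge (relabeled s) (relabeled-connected s) k (treeEdge-joins⁻¹ k (inj₁ (refl , refl))))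
    where t = treeEdge k

  edges-↭ : edges ↭ map (ends ∘ treeEdge) (allFin m)
  edges-↭ = unique-complete⇒↭
    (Unique.filter⁺ edge? (Unique.cartesianProduct⁺ (Unique.allFin⁺ (suc m)) (Unique.allFin⁺ (suc m))))
    (Unique.map⁺ treeEdge-injective (Unique.allFin⁺ m)) to from
    where
    edge? : U.Decidable λ (u , v) → u Fin.< v × u ~ v
    edge? (u , v) = u <? v ×-dec u ~? v

    to : ∀ {e} → e ∈ edges → e ∈ map (ends ∘ treeEdge) (allFin m)
    to {u , v} e∈ with proj₂ (∈-filter⁻ edge? {xs = cartesianProduct (allFin (suc m)) (allFin (suc m))} e∈)
    ... | u<v , k , j = subst (_∈ map (ends ∘ treeEdge) (allFin m))
            (cong ends (joins-ends-injective {t = treeEdge k} {mkTransposition u v u<v}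
                         (treeEdge-joins k j) (inj₁ (refl , refl))))
            (∈-map⁺ (ends ∘ treeEdge) (∈-allFin k))

    from : ∀ {e} → e ∈ map (ends ∘ treeEdge) (allFin m) → e ∈ edges
    from e∈ with ∈-map⁻ (ends ∘ treeEdge) e∈
    ... | k , _ , refl = ∈-filter⁺ edge? (∈-cartesianProduct⁺ (∈-allFin _) (∈-allFin _))
            (lo<hi′ (treeEdge k) , k , treeEdge-joins⁻¹ k (inj₁ (refl , refl)))

  -- `Without` removes a label, `delete` a pair of ends. They agree because a second label on these
  -- ends would bypass the bridge `k`.
  without⇒delete : ∀ k {a b} → Without (labeledGraph (proj₁ s)) k a b →
                   delete (ends (treeEdge k)) (relabel s a) (relabel s b)
  without⇒delete k (k′ , k≢k′ , j) = (k′ , relabel-Joins s k′ j) , λ j′ →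
    bridge (relabeled s) (relabeled-connected s) k (treeEdge-joins⁻¹ k j′)
      (return (k′ , k≢k′ , relabel-Joins s k′ j))

  treeEdge-bridge : ∀ k → ¬ Star (delete (ends (treeEdge k))) (lo (treeEdge k)) (hi (treeEdge k))
  treeEdge-bridge k = bridge (relabeled s) (relabeled-connected s) k (treeEdge-joins⁻¹ k (inj₁ (refl , refl)))
    ∘ gmap id λ { ((k′ , j) , not) → k′ , (λ { refl → not (treeEdge-joins k j) }) , j }

-- The ends of edge `k` in the dual are the minds above `lo t` and `hi t`, not these points
-- themselves, so it is not known which end shares a component with which arc; `size-⊓` allows for
-- this. Renaming by the injection `r` keeps the sizes of the arcs.
cIndex≡tIndex : (s : F↓ m) (k : Fin m) → cIndex (proj₁ s) k ≡ Tree.tIndex (B s) (ends (treeEdge (D s) k))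
cIndex≡tIndex {m} s k = sym (trans
  (size-⊓ (connected? (delete? (ends (treeEdge (D s) k)))) (reverse (delete-sym (B s) _)) _◅◅_
          all↭ (lift (proj₁ linked)) (lift (proj₂ linked)) (treeEdge-bridge (D s) k))
  (cong₂ _⊓_ (length-map r xs) (length-map r ys)))
  where
  open Tree (B s) using (delete; delete?)
  π = prod (proj₁ s)
  t = lookup (proj₁ s) k
  r = relabel (D s)
  c = cycleFrom π (lo t)
  xs = takeWhile (λ z → ¬? (z ≟ hi t)) c
  ys = dropWhile (λ z → ¬? (z ≟ hi t)) c

  full : ∀ v → Orbit π (lo t) v
  full = descending-transitive s (lo t)

  linked : All (Star (Without (labeledGraph (dual (proj₁ s))) k) (lo t)) xs ×
           All (Star (Without (labeledGraph (dual (proj₁ s))) k) (hi t)) ys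
  linked = cycle-linked ε _◅◅_ (π ⟨$⟩ʳ_) (lo t) (hi t) (dual-linked (proj₁ s) k) (suc m) (lo≢hi t)
             (cycleFrom-unique π full)

  lift : ∀ {a zs} → All (Star (Without (labeledGraph (dual (proj₁ s))) k) a) zs →
         All (Star (delete (ends (treeEdge (D s) k))) (r a)) (map r zs)
  lift ws = All.map⁺ (All.map (gmap r (without⇒delete (D s) k)) ws)

  complete : ∀ v → v ∈ map r c
  complete v with injective⇒onto (relabel-injective (D s)) v
  ... | u , refl = ∈-map⁺ r (cycleFrom-complete π full u)

  all↭ : allFin (suc m) ↭ map r xs ++ map r ys
  all↭ = ↭-trans
    (unique-complete⇒↭ (Unique.allFin⁺ (suc m)) (Unique.map⁺ (relabel-injective (D s)) (cycleFrom-unique π full))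
      (λ _ → complete _) (λ _ → ∈-allFin _))
    (↭-reflexive (trans (cong (map r) (sym (takeWhile++dropWhile (λ z → ¬? (z ≟ hi t)) c))) (map-++ r xs ys)))

index-↭ : (s : F↓ m) → map (cIndex (proj₁ s)) (allFin m) ↭ map (Tree.tIndex (B s)) (Tree.edges (B s))
index-↭ {m} s = ↭-sym (↭-trans (↭.map⁺ (Tree.tIndex (B s)) (edges-↭ (D s)))
  (↭-reflexive (trans (sym (map-∘ (allFin m))) (map-cong (sym ∘ cIndex≡tIndex s) (allFin m)))))

-- Bijectivity of `B`

B-isBijection : IsBijection _≈F_ _≈T_ (B {m})
B-isBijection = record
  { isInjection = record
    { isCongruent = record
      { cong = λ {s} {s′} eq → S-congruent (D s) (D s′) (cong dual eq)
      ; isEquivalence₁ = On.isEquivalence proj₁ isEquivalence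
      ; isEquivalence₂ = record
        { refl  = λ u v → mk⇔ id id
        ; sym   = λ eq u v → ⇔.sym (eq u v)
        ; trans = λ eq eq′ u v → ⇔.trans (eq u v) (eq′ u v)
        }
      }
    ; injective = λ {s} {s′} eq → dualFrom-injective Perm.id (S-injective (D s) (D s′) eq)
    }
  ; surjective = λ T →
      let s′ , eq = S-surjective T
          s , eq′ = D-surjective s′
      -- `D z` and `s′` have the same sequence but possibly different proofs about its product;
      -- `S-congruent` absorbs the difference.
      in s , λ {z} z≈s u v → ⇔.trans (S-congruent (D z) s′ (trans (cong dual z≈s) eq′) u v) (eq u v)
  }

theorem6p7 : (m : ℕ) →
    IsBijection _≈F_ _≈T_ (B {m}) ×
    ((s : F↓ m) → map (cIndex (proj₁ s)) (allFin m) ↭ map (Tree.tIndex (B s)) (Tree.edges (B s)))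
theorem6p7 m = B-isBijection , index-↭
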